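{- Let $m\ge 2$ be an integer. The set $$G=\{f_k^{(m)}(x): k\in\mathbb{Z}\}$$ is an infinite abelian group under multiplication modulo $\Psi_m(x)$.
   Context: For a positive integer $m$ let $\Psi_m(x)=\sum_{j=0}^{m-1}x^j$. For $m\ge2$ the polynomial $1-x$ is invertible modulo $\Psi_m(x)$ over $\mathbb{Q}$; for $k\in\mathbb{Z}$, $f_k^{(m)}(x)\in\mathbb{Q}[x]$ denotes the unique polynomial of degree less than $m-1$ congruent to $(1-x)^{ -k}$ modulo $\Psi_m(x)$. Multiplication modulo $\Psi_m(x)$ means taking the product of two polynomials and then its remainder upon division by $\Psi_m(x)$. -}

module Defs where

open import Data.Integer.Base as ℤ using (ℤ; -[1+_])
  renaming (+_ to ℤ+_)
import Data.Integer.Properties as ℤ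
open import Data.List.Base using (List; []; _∷_; map; replicate)
open import Data.Nat.Base as ℕ using (ℕ; zero; suc; z≤n; s≤s)
import Data.Nat.Coprimality as Coprimality
import Data.Nat.Properties as ℕ
open import Data.Product.Base using (∃; _,_; proj₁; proj₂)
open import Data.Rational.Base using (ℚ; mkℚ; 0ℚ; 1ℚ; _+_; _*_; -_; 1/_; toℚᵘ)
open import Data.Rational.Properties
  using (+-identityˡ; +-identityʳ; *-identityʳ; *-zeroʳ; *-inverseˡ; toℚᵘ-injective; toℚᵘ-homo-+)
import Data.Rational.Solver as ℚSolver
import Data.Rational.Unnormalised.Base as ℚᵘ
import Data.Rational.Unnormalised.Properties as ℚᵘ
open import Level using (0ℓ)
open import Relation.Binary.Bundles using (Setoid)
open import Relation.Binary.PropositionalEquality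
  using (_≡_; refl; sym; trans; cong; cong₂; module ≡-Reasoning)
import Relation.Binary.Construct.On as On
open import Relation.Nullary.Decidable.Core using (yes; no)
open import Relation.Unary using (Pred)

open ℚSolver.+-*-Solver using (solve; _:+_; _:*_; :-_; _:=_; con)

------------------------------------------------------------------------
-- ℚ[x]

-- The list a₀ ∷ a₁ ∷ … represents a₀ + a₁x + …; trailing zeros are
-- allowed, so polynomials are compared by _≈_ and not by _≡_.

Poly : Set
Poly = List ℚ

coeff : Poly → ℕ → ℚ
coeff []      _       = 0ℚ
coeff (a ∷ _) zero    = a
coeff (_ ∷ p) (suc i) = coeff p i

infix 4 _≈_

record _≈_ (p q : Poly) : Set where
  constructor mk≈
  field
    coeff≡ : ∀ i → coeff p i ≡ coeff q i

open _≈_ public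

polySetoid : Setoid 0ℓ 0ℓ
polySetoid = record
  { Carrier       = Poly
  ; _≈_           = _≈_
  ; isEquivalence = record
    { refl  = mk≈ λ _ → refl
    ; sym   = λ p≈q → mk≈ λ i → sym (coeff≡ p≈q i)
    ; trans = λ p≈q q≈r → mk≈ λ i → trans (coeff≡ p≈q i) (coeff≡ q≈r i)
    }
  }

infixl 6 _+ᴾ_
infixl 7 _*ᴾ_
infixr 7 _·_
infixr 8 _^ᴾ_

_+ᴾ_ : Poly → Poly → Poly
[]      +ᴾ q       = q
(a ∷ p) +ᴾ []      = a ∷ p
(a ∷ p) +ᴾ (b ∷ q) = (a + b) ∷ (p +ᴾ q)

_·_ : ℚ → Poly → Poly
c · p = map (c *_) p

_*ᴾ_ : Poly → Poly → Poly
[]      *ᴾ q = []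
(a ∷ p) *ᴾ q = (a · q) +ᴾ (0ℚ ∷ (p *ᴾ q))

1ᴾ : Poly
1ᴾ = 1ℚ ∷ []

_^ᴾ_ : Poly → ℕ → Poly
p ^ᴾ zero  = 1ᴾ
p ^ᴾ suc n = p *ᴾ (p ^ᴾ n)

-- The zero polynomial has degree less than n for every n.

Degree<_ : ℕ → Pred Poly 0ℓ
(Degree< n) p = ∀ i → n ℕ.≤ i → coeff p i ≡ 0ℚ

infix 4 _≡_[mod_]

_≡_[mod_] : Poly → Poly → Poly → Set
p ≡ q [mod d ] = ∃ λ c → p ≈ c *ᴾ d +ᴾ q

coeff-+ : ∀ p q i → coeff (p +ᴾ q) i ≡ coeff p i + coeff q i
coeff-+ []      q       i       = sym (+-identityˡ _)
coeff-+ (a ∷ p) []      i       = sym (+-identityʳ _)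
coeff-+ (a ∷ p) (b ∷ q) zero    = refl
coeff-+ (a ∷ p) (b ∷ q) (suc i) = coeff-+ p q i

coeff-· : ∀ c p i → coeff (c · p) i ≡ c * coeff p i
coeff-· c []      i       = sym (*-zeroʳ c)
coeff-· c (a ∷ p) zero    = refl
coeff-· c (a ∷ p) (suc i) = coeff-· c p i

------------------------------------------------------------------------
-- Ψₘ = 1 + x + … + xᵐ⁻¹ and division by it

Ψ : ℕ → Poly
Ψ m = replicate m 1ℚ

coeff-Ψ-last : ∀ n → coeff (Ψ (suc n)) n ≡ 1ℚ
coeff-Ψ-last zero    = refl
coeff-Ψ-last (suc n) = coeff-Ψ-last n

Ψ-degree : ∀ m → (Degree< m) (Ψ m)
Ψ-degree zero    i       _         = refl
Ψ-degree (suc m) (suc i) (s≤s m≤i) = Ψ-degree m i m≤i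

record DivisionΨ (m : ℕ) (p : Poly) : Set where
  constructor result
  field
    quotient         : Poly
    remainder        : Poly
    property         : p ≈ quotient *ᴾ Ψ m +ᴾ remainder
    remainder-degree : (Degree< (m ℕ.∸ 1)) remainder

open DivisionΨ public

divΨ : ∀ m .{{_ : ℕ.NonZero m}} p → DivisionΨ m p
divΨ (suc n) [] = result [] [] (mk≈ λ _ → refl) (λ _ _ → refl)
divΨ (suc n) (a ∷ p) with divΨ (suc n) p
... | result q r p≈ r-deg = result (c ∷ q) s (mk≈ prop) s-deg
  where
  c = coeff (a ∷ r) n
  s = (a ∷ r) +ᴾ ((- c) · Ψ (suc n))

  coeff-s : ∀ i → coeff s i ≡ coeff (a ∷ r) i + (- c) * coeff (Ψ (suc n)) i
  coeff-s i = trans (coeff-+ (a ∷ r) ((- c) · Ψ (suc n)) i)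
                    (cong (coeff (a ∷ r) i +_) (coeff-· (- c) (Ψ (suc n)) i))

  shift : ∀ i → coeff (a ∷ p) i ≡ coeff (0ℚ ∷ (q *ᴾ Ψ (suc n))) i + coeff (a ∷ r) i
  shift zero    = sym (+-identityˡ a)
  shift (suc i) = trans (coeff≡ p≈ i) (coeff-+ (q *ᴾ Ψ (suc n)) r i)

  prop : ∀ i → coeff (a ∷ p) i ≡ coeff ((c ∷ q) *ᴾ Ψ (suc n) +ᴾ s) i
  prop i = begin
    coeff (a ∷ p) i
      ≡⟨ shift i ⟩
    z + t
      ≡⟨ solve 4 (λ C Z T U → Z :+ T := (C :* U :+ Z) :+ (T :+ (:- C) :* U)) refl c z t u ⟩
    (c * u + z) + (t + (- c) * u)
      ≡⟨ cong₂ _+_ (cong (_+ z) (coeff-· c (Ψ (suc n)) i)) (coeff-s i) ⟨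
    (coeff (c · Ψ (suc n)) i + z) + coeff s i
      ≡⟨ cong (_+ coeff s i) (coeff-+ (c · Ψ (suc n)) (0ℚ ∷ (q *ᴾ Ψ (suc n))) i) ⟨
    coeff ((c ∷ q) *ᴾ Ψ (suc n)) i + coeff s i
      ≡⟨ coeff-+ ((c ∷ q) *ᴾ Ψ (suc n)) s i ⟨
    coeff ((c ∷ q) *ᴾ Ψ (suc n) +ᴾ s) i ∎
    where
    open ≡-Reasoning
    z = coeff (0ℚ ∷ (q *ᴾ Ψ (suc n))) i
    t = coeff (a ∷ r) i
    u = coeff (Ψ (suc n)) i

  tail-vanishes : ∀ i → n ℕ.< i → coeff (a ∷ r) i ≡ 0ℚ
  tail-vanishes (suc i) (s≤s n≤i) = r-deg i n≤i

  s-deg : (Degree< n) s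
  s-deg i n≤i with n ℕ.≟ i
  ... | yes refl = begin
    coeff s n                                  ≡⟨ coeff-s n ⟩
    c + (- c) * coeff (Ψ (suc n)) n            ≡⟨ cong (λ u → c + (- c) * u) (coeff-Ψ-last n) ⟩
    c + (- c) * 1ℚ                             ≡⟨ solve 1 (λ C → C :+ (:- C) :* con 1ℚ := con 0ℚ) refl c ⟩
    0ℚ                                         ∎
    where open ≡-Reasoning
  ... | no n≢i = begin
    coeff s i                                     ≡⟨ coeff-s i ⟩
    coeff (a ∷ r) i + (- c) * coeff (Ψ (suc n)) i ≡⟨ cong₂ (λ t u → t + (- c) * u) (tail-vanishes i n<i) (Ψ-degree (suc n) i n<i) ⟩
    0ℚ + (- c) * 0ℚ                               ≡⟨ solve 1 (λ C → con 0ℚ :+ (:- C) :* con 0ℚ := con 0ℚ) refl c ⟩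
    0ℚ                                            ∎
    where
    open ≡-Reasoning
    n<i = ℕ.≤∧≢⇒< n≤i n≢i

------------------------------------------------------------------------
-- The inverse of 1 - x modulo Ψₘ

1-x : Poly
1-x = 1ℚ ∷ - 1ℚ ∷ []

fromℕ : ℕ → ℚ
fromℕ n = mkℚ (ℤ+ n) 0 (Coprimality.sym (Coprimality.1-coprimeTo n))

fromℕ-suc : ∀ n → fromℕ (suc n) ≡ 1ℚ + fromℕ n
fromℕ-suc n = toℚᵘ-injective (ℚᵘ.≃-trans
  (ℚᵘ.*≡* (cong (ℤ._* ℤ+ 1) (cong (λ k → (ℤ+ 1) ℤ.+ k) (sym (ℤ.*-identityʳ (ℤ+ n))))))
  (ℚᵘ.≃-sym (toℚᵘ-homo-+ 1ℚ (fromℕ n))))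

-- n + (n - 1)x + … + 1·xⁿ⁻¹

countdown : ℕ → Poly
countdown zero    = []
countdown (suc n) = fromℕ (suc n) ∷ countdown n

-- The inverse comes from  (1 - x) · Σ_{j<m} (m - 1 - j) xʲ = m - Ψₘ.

1-x-invertible : ∀ m .{{_ : ℕ.NonTrivial m}} →
                 ∃ λ g → 1-x *ᴾ g ≡ 1ᴾ [mod Ψ m ]
1-x-invertible (suc (suc n)) = u · countdown (suc n) , ((- u) ∷ []) , mk≈ eq
  where
  open ≡-Reasoning
  m = suc (suc n)
  u = 1/ fromℕ m
  g = u · countdown (suc n)

  coeff-0 : ∀ i → coeff (0ℚ ∷ []) i ≡ 0ℚ
  coeff-0 zero    = refl
  coeff-0 (suc _) = refl

  lhs : ∀ i → coeff (1-x *ᴾ g) (suc i) ≡ coeff g (suc i) + (- coeff g i)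
  lhs i = begin
    coeff (1-x *ᴾ g) (suc i)
      ≡⟨ coeff-+ (1ℚ · g) (0ℚ ∷ ((- 1ℚ ∷ []) *ᴾ g)) (suc i) ⟩
    coeff (1ℚ · g) (suc i) + coeff ((- 1ℚ · g) +ᴾ (0ℚ ∷ [])) i
      ≡⟨ cong₂ _+_ (coeff-· 1ℚ g (suc i))
           (trans (coeff-+ (- 1ℚ · g) (0ℚ ∷ []) i) (cong₂ _+_ (coeff-· (- 1ℚ) g i) (coeff-0 i))) ⟩
    1ℚ * coeff g (suc i) + ((- 1ℚ) * coeff g i + 0ℚ)
      ≡⟨ solve 2 (λ A B → con 1ℚ :* A :+ (con (- 1ℚ) :* B :+ con 0ℚ) := A :+ (:- B)) refl (coeff g (suc i)) (coeff g i) ⟩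
    coeff g (suc i) + (- coeff g i) ∎

  rhs : ∀ i → coeff (((- u) ∷ []) *ᴾ Ψ m +ᴾ 1ᴾ) i ≡ (- u) * coeff (Ψ m) i + coeff 1ᴾ i
  rhs i = begin
    coeff (((- u) ∷ []) *ᴾ Ψ m +ᴾ 1ᴾ) i
      ≡⟨ coeff-+ (((- u) ∷ []) *ᴾ Ψ m) 1ᴾ i ⟩
    coeff (((- u) · Ψ m) +ᴾ (0ℚ ∷ [])) i + coeff 1ᴾ i
      ≡⟨ cong (_+ coeff 1ᴾ i) (trans (coeff-+ ((- u) · Ψ m) (0ℚ ∷ []) i) (cong₂ _+_ (coeff-· (- u) (Ψ m) i) (coeff-0 i))) ⟩
    ((- u) * coeff (Ψ m) i + 0ℚ) + coeff 1ᴾ i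
      ≡⟨ cong (_+ coeff 1ᴾ i) (+-identityʳ ((- u) * coeff (Ψ m) i)) ⟩
    (- u) * coeff (Ψ m) i + coeff 1ᴾ i ∎

  step : ∀ k i → coeff (countdown k) (suc i) + (- coeff (countdown k) i) ≡ - coeff (Ψ k) i
  step zero    i       = refl
  step (suc zero) zero = refl
  step (suc (suc k)) zero = begin
    fromℕ (suc k) + (- fromℕ (suc (suc k)))      ≡⟨ cong (λ t → fromℕ (suc k) + (- t)) (fromℕ-suc (suc k)) ⟩
    fromℕ (suc k) + (- (1ℚ + fromℕ (suc k)))     ≡⟨ solve 1 (λ A → A :+ (:- (con 1ℚ :+ A)) := :- con 1ℚ) refl (fromℕ (suc k)) ⟩
    - 1ℚ                                         ∎
  step (suc k) (suc i) = step k i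

  eq : ∀ i → coeff (1-x *ᴾ g) i ≡ coeff (((- u) ∷ []) *ᴾ Ψ m +ᴾ 1ᴾ) i
  eq zero = begin
    1ℚ * (u * fromℕ (suc n)) + 0ℚ
      ≡⟨ solve 2 (λ U A → con 1ℚ :* (U :* A) :+ con 0ℚ := (:- U) :+ U :* (con 1ℚ :+ A)) refl u (fromℕ (suc n)) ⟩
    (- u) + u * (1ℚ + fromℕ (suc n))
      ≡⟨ cong (λ t → (- u) + u * t) (fromℕ-suc (suc n)) ⟨
    (- u) + u * fromℕ m
      ≡⟨ cong₂ _+_ (sym (*-identityʳ (- u))) (*-inverseˡ (fromℕ m)) ⟩
    (- u) * 1ℚ + 1ℚ
      ≡⟨ rhs 0 ⟨
    coeff (((- u) ∷ []) *ᴾ Ψ m +ᴾ 1ᴾ) 0 ∎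
  eq (suc i) = begin
    coeff (1-x *ᴾ g) (suc i)
      ≡⟨ lhs i ⟩
    coeff g (suc i) + (- coeff g i)
      ≡⟨ cong₂ (λ s t → s + (- t)) (coeff-· u (countdown (suc n)) (suc i)) (coeff-· u (countdown (suc n)) i) ⟩
    u * a + (- (u * b))
      ≡⟨ solve 3 (λ U A B → U :* A :+ (:- (U :* B)) := U :* (A :+ (:- B))) refl u a b ⟩
    u * (a + (- b))
      ≡⟨ cong (u *_) (step (suc n) i) ⟩
    u * (- coeff (Ψ (suc n)) i)
      ≡⟨ solve 2 (λ U A → U :* (:- A) := (:- U) :* A :+ con 0ℚ) refl u (coeff (Ψ (suc n)) i) ⟩
    (- u) * coeff (Ψ m) (suc i) + 0ℚ
      ≡⟨ rhs (suc i) ⟨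
    coeff (((- u) ∷ []) *ᴾ Ψ m +ᴾ 1ᴾ) (suc i) ∎
    where
    a = coeff (countdown (suc n)) (suc i)
    b = coeff (countdown (suc n)) i

------------------------------------------------------------------------
-- The polynomials f_k and the set G

module _ (m : ℕ) .{{m≥2 : ℕ.NonTrivial m}} where

  private instance
    m≢0 : ℕ.NonZero m
    m≢0 = ℕ.nonTrivial⇒nonZero m

  rem : Poly → Poly
  rem p = remainder (divΨ m p)

  mulMod : Poly → Poly → Poly
  mulMod p q = rem (p *ᴾ q)

  -- A representative of (1 - x)ᵏ modulo Ψₘ; negative powers are powers of
  -- the inverse of 1 - x.

  [1-x]^ : ℤ → Poly
  [1-x]^ (ℤ+ n)   = 1-x ^ᴾ n
  [1-x]^ -[1+ n ] = proj₁ (1-x-invertible m) ^ᴾ suc n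

  f : ℤ → Poly
  f k = rem ([1-x]^ (ℤ.- k))

  f-congruent : ∀ k → [1-x]^ (ℤ.- k) ≡ f k [mod Ψ m ]
  f-congruent k = quotient d , property d
    where d = divΨ m ([1-x]^ (ℤ.- k))

  f-degree : ∀ k → (Degree< (m ℕ.∸ 1)) (f k)
  f-degree k = remainder-degree (divΨ m ([1-x]^ (ℤ.- k)))

  G : Pred Poly 0ℓ
  G p = ∃ λ k → p ≈ f k

  G-setoid : Setoid 0ℓ 0ℓ
  G-setoid = On.setoid {B = ∃ G} polySetoid proj₁

  Closed : Set
  Closed = ∀ {p q} → G p → G q → G (mulMod p q)

  -- Multiplication modulo Ψₘ restricted to G, given that G is closed under it.

  mulG : Closed → ∃ G → ∃ G → ∃ G
  mulG closed (p , p∈G) (q , q∈G) = mulMod p q , closed p∈G q∈G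

{-# OPTIONS --safe #-}

-- Modulo Ψₘ the powers of 1 - x and of its inverse multiply by adding exponents,
-- and a residue class has only one representative of degree less than m - 1, so
-- the group laws of G are those of (ℤ, +).  G is infinite because 1 - x is not a
-- root of unity modulo Ψₘ: if 1 = c Ψₘ + (1 - x)ᵏ with k ≥ 1, then c has integer
-- coefficients, Ψₘ having constant term 1, and evaluating at x = 1 gives
-- 1 = c(1) m, which is impossible for m ≥ 2.

module Submission where

open import Defs
open import Algebra.Structures using (IsAbelianGroup)
open import Data.Nat.Base using (ℕ; NonTrivial)
open import Data.Product.Base using (∃; ∃₂; Σ-syntax; _×_)
open import Function.Bundles using (Injection)
open import Relation.Binary.Bundles using (Setoid)
open import Relation.Binary.PropositionalEquality using (setoid)

open import Algebra.Bundles 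
  using (RawGroup; CommutativeSemigroup; CommutativeMonoid; CommutativeRing)
import Algebra.Consequences.Setoid as Consequences
import Algebra.Construct.Pointwise as Pointwise
import Algebra.Morphism.GroupMonomorphism as GroupMonomorphism
open import Algebra.Morphism.Structures using (IsGroupMonomorphism)
import Algebra.Properties.CommutativeSemigroup as CommutativeSemigroupProperties
import Algebra.Properties.Ring as RingProperties
open import Data.Empty using (⊥; ⊥-elim)
open import Data.Integer.Base as ℤ using (ℤ; -[1+_])
import Data.Integer.Properties as ℤ
open import Data.List.Base using ([]; _∷_)
open import Data.Nat.Base as ℕ using (zero; suc; s≤s)
import Data.Nat.Properties as ℕ
open import Data.Product.Base using (_,_; proj₁; proj₂)
open import Data.Rational.Base using (ℚ; 0ℚ; 1ℚ; _+_; _*_; -_; ↥_)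
open import Data.Rational.Literals using (fromℤ)
import Data.Rational.Properties as ℚ
import Data.Rational.Solver as ℚSolver
import Data.Rational.Unnormalised.Base as ℚᵘ
import Data.Rational.Unnormalised.Properties as ℚᵘ
open import Level using (0ℓ)
open import Relation.Binary.PropositionalEquality
  using (_≡_; refl; sym; trans; cong; cong₂; subst; module ≡-Reasoning)
import Relation.Binary.Reasoning.Setoid as SetoidReasoning

open ℚSolver.+-*-Solver using (solve; _:+_; _:*_; :-_; _:=_; con)

private
  variable
    a b : ℚ
    p p′ q q′ r d : Poly

-- The commutative ring ℚ[x]

+ᴾ-rawGroup : RawGroup 0ℓ 0ℓ
+ᴾ-rawGroup = record { _≈_ = _≈_ ; _∙_ = _+ᴾ_ ; ε = [] ; _⁻¹ = - 1ℚ ·_ }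

coefficients-rawGroup : RawGroup 0ℓ 0ℓ
coefficients-rawGroup = record
  { Carrier = ℕ → ℚ
  ; _≈_ = λ s t → ∀ i → s i ≡ t i
  ; _∙_ = λ s t i → s i + t i
  ; ε   = λ _ → 0ℚ
  ; _⁻¹ = λ s i → - s i
  }

-- Since `_≈_` is equality of all coefficients, `coeff` embeds polynomials into the sequences
-- `ℕ → ℚ`. The abelian group laws of `_+ᴾ_` are thus pulled back from the pointwise ones, with no
-- induction on lists.
coeff-isGroupMonomorphism : IsGroupMonomorphism +ᴾ-rawGroup coefficients-rawGroup coeff
coeff-isGroupMonomorphism = record
  { isGroupHomomorphism = record
    { isMonoidHomomorphism = record
      { isMagmaHomomorphism = record
        { isRelHomomorphism = record { cong = coeff≡ }
        ; homo = coeff-+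
        }
      ; ε-homo = λ _ → refl
      }
    ; ⁻¹-homo = λ p i → trans (coeff-· (- 1ℚ) p i)
        (solve 1 (λ A → con (- 1ℚ) :* A := :- A) refl (coeff p i))
    }
  ; injective = mk≈
  }

+ᴾ-isAbelianGroup : IsAbelianGroup _≈_ _+ᴾ_ [] (- 1ℚ ·_)
+ᴾ-isAbelianGroup = GroupMonomorphism.isAbelianGroup coeff-isGroupMonomorphism
  (Pointwise.isAbelianGroup ℕ ℚ.+-0-isAbelianGroup)

open IsAbelianGroup +ᴾ-isAbelianGroup using ()
  renaming ( refl to ≈-refl; sym to ≈-sym; trans to ≈-trans
           ; ∙-cong to +ᴾ-cong; ∙-congˡ to +ᴾ-congˡ; ∙-congʳ to +ᴾ-congʳ
           ; identityʳ to +ᴾ-identityʳ)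

+ᴾ-commutativeSemigroup : CommutativeSemigroup 0ℓ 0ℓ
+ᴾ-commutativeSemigroup = record
  { isCommutativeSemigroup = IsAbelianGroup.isCommutativeSemigroup +ᴾ-isAbelianGroup }

open CommutativeSemigroupProperties +ᴾ-commutativeSemigroup
  using () renaming (interchange to +ᴾ-interchange; x∙yz≈y∙xz to p+qr≈q+pr)

∷-cong : a ≡ b → p ≈ q → a ∷ p ≈ b ∷ q
∷-cong a≡b p≈q = mk≈ λ { zero → a≡b ; (suc i) → coeff≡ p≈q i }

0∷[]≈[] : 0ℚ ∷ [] ≈ []
0∷[]≈[] = mk≈ λ { zero → refl ; (suc i) → refl }

·-cong : ∀ c → p ≈ q → c · p ≈ c · q
·-cong {p} {q} c p≈q = mk≈ λ i → begin
  coeff (c · p) i ≡⟨ coeff-· c p i ⟩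
  c * coeff p i   ≡⟨ cong (c *_) (coeff≡ p≈q i) ⟩
  c * coeff q i   ≡⟨ coeff-· c q i ⟨
  coeff (c · q) i ∎
  where open ≡-Reasoning

·-distribˡ : ∀ c p q → c · (p +ᴾ q) ≈ c · p +ᴾ c · q
·-distribˡ c p q = mk≈ λ i → begin
  coeff (c · (p +ᴾ q)) i            ≡⟨ coeff-· c (p +ᴾ q) i ⟩
  c * coeff (p +ᴾ q) i              ≡⟨ cong (c *_) (coeff-+ p q i) ⟩
  c * (coeff p i + coeff q i)       ≡⟨ ℚ.*-distribˡ-+ c _ _ ⟩
  c * coeff p i + c * coeff q i     ≡⟨ cong₂ _+_ (coeff-· c p i) (coeff-· c q i) ⟨
  coeff (c · p) i + coeff (c · q) i ≡⟨ coeff-+ (c · p) (c · q) i ⟨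
  coeff (c · p +ᴾ c · q) i          ∎
  where open ≡-Reasoning

·-distribʳ : ∀ p a b → (a + b) · p ≈ a · p +ᴾ b · p
·-distribʳ p a b = mk≈ λ i → begin
  coeff ((a + b) · p) i             ≡⟨ coeff-· (a + b) p i ⟩
  (a + b) * coeff p i               ≡⟨ ℚ.*-distribʳ-+ _ a b ⟩
  a * coeff p i + b * coeff p i     ≡⟨ cong₂ _+_ (coeff-· a p i) (coeff-· b p i) ⟨
  coeff (a · p) i + coeff (b · p) i ≡⟨ coeff-+ (a · p) (b · p) i ⟨
  coeff (a · p +ᴾ b · p) i          ∎
  where open ≡-Reasoning

·-assoc : ∀ a b p → (a * b) · p ≈ a · b · p
·-assoc a b p = mk≈ λ i → begin
  coeff ((a * b) · p) i ≡⟨ coeff-· (a * b) p i ⟩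
  (a * b) * coeff p i   ≡⟨ ℚ.*-assoc a b _ ⟩
  a * (b * coeff p i)   ≡⟨ cong (a *_) (coeff-· b p i) ⟨
  a * coeff (b · p) i   ≡⟨ coeff-· a (b · p) i ⟨
  coeff (a · b · p) i   ∎
  where open ≡-Reasoning

·-zeroˡ : ∀ p → 0ℚ · p ≈ []
·-zeroˡ p = mk≈ λ i → trans (coeff-· 0ℚ p i) (ℚ.*-zeroˡ (coeff p i))

·-identityˡ : ∀ p → 1ℚ · p ≈ p
·-identityˡ p = mk≈ λ i → trans (coeff-· 1ℚ p i) (ℚ.*-identityˡ (coeff p i))

*ᴾ-congˡ : ∀ p → q ≈ q′ → p *ᴾ q ≈ p *ᴾ q′
*ᴾ-congˡ []      q≈q′ = ≈-refl
*ᴾ-congˡ (a ∷ p) q≈q′ = +ᴾ-cong (·-cong a q≈q′) (∷-cong refl (*ᴾ-congˡ p q≈q′))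

*ᴾ-zeroʳ : ∀ p → p *ᴾ [] ≈ []
*ᴾ-zeroʳ []      = ≈-refl
*ᴾ-zeroʳ (a ∷ p) = ≈-trans (∷-cong refl (*ᴾ-zeroʳ p)) 0∷[]≈[]

-- The mirror image of the recursive clause of `_*ᴾ_`, expanding along the second factor.
-- Commutativity then follows by induction on the first factor.
*ᴾ-∷ : ∀ p b q → p *ᴾ (b ∷ q) ≈ b · p +ᴾ (0ℚ ∷ p *ᴾ q)
*ᴾ-∷ []      b q = ≈-sym 0∷[]≈[]
*ᴾ-∷ (a ∷ p) b q = ∷-cong (cong (_+ 0ℚ) (ℚ.*-comm a b))
  (≈-trans (+ᴾ-congˡ (*ᴾ-∷ p b q)) (p+qr≈q+pr (a · q) (b · p) (0ℚ ∷ p *ᴾ q)))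

*ᴾ-comm : ∀ p q → p *ᴾ q ≈ q *ᴾ p
*ᴾ-comm []      q = ≈-sym (*ᴾ-zeroʳ q)
*ᴾ-comm (a ∷ p) q =
  ≈-trans (+ᴾ-congˡ (∷-cong refl (*ᴾ-comm p q))) (≈-sym (*ᴾ-∷ q a p))

*ᴾ-distribʳ-+ᴾ : ∀ r p q → (p +ᴾ q) *ᴾ r ≈ p *ᴾ r +ᴾ q *ᴾ r
*ᴾ-distribʳ-+ᴾ r []      q       = ≈-refl
*ᴾ-distribʳ-+ᴾ r (a ∷ p) []      = ≈-sym (+ᴾ-identityʳ _)
*ᴾ-distribʳ-+ᴾ r (a ∷ p) (b ∷ q) = ≈-trans
  (+ᴾ-cong (·-distribʳ r a b) (∷-cong refl (*ᴾ-distribʳ-+ᴾ r p q)))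
  (+ᴾ-interchange (a · r) (b · r) (0ℚ ∷ p *ᴾ r) (0ℚ ∷ q *ᴾ r))

·-*ᴾ-assoc : ∀ a p q → (a · p) *ᴾ q ≈ a · (p *ᴾ q)
·-*ᴾ-assoc a []      q = ≈-refl
·-*ᴾ-assoc a (b ∷ p) q = ≈-trans
  (+ᴾ-cong (·-assoc a b q) (∷-cong (sym (ℚ.*-zeroʳ a)) (·-*ᴾ-assoc a p q)))
  (≈-sym (·-distribˡ a (b · q) (0ℚ ∷ p *ᴾ q)))

*ᴾ-assoc : ∀ p q r → (p *ᴾ q) *ᴾ r ≈ p *ᴾ (q *ᴾ r)
*ᴾ-assoc []      q r = ≈-refl
*ᴾ-assoc (a ∷ p) q r = ≈-trans (*ᴾ-distribʳ-+ᴾ r (a · q) (0ℚ ∷ p *ᴾ q))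
  (+ᴾ-cong (·-*ᴾ-assoc a q r)
           -- Multiplying out the shifted factor `0ℚ ∷ p *ᴾ q` produces an extra summand `0ℚ · r`,
           -- which is discarded here.
           (+ᴾ-cong (·-zeroˡ r) (∷-cong refl (*ᴾ-assoc p q r))))

*ᴾ-identityˡ : ∀ p → 1ᴾ *ᴾ p ≈ p
*ᴾ-identityˡ p = ≈-trans (+ᴾ-cong (·-identityˡ p) 0∷[]≈[]) (+ᴾ-identityʳ p)

polyRing : CommutativeRing 0ℓ 0ℓ
polyRing = record
  { 0#  = []
  ; 1#  = 1ᴾ
  ; isCommutativeRing = record
    { isRing = record
      { +-isAbelianGroup = +ᴾ-isAbelianGroup
      ; *-cong = λ {p} {p′} {q} {q′} p≈p′ q≈q′ → ≈-trans (*ᴾ-congˡ p q≈q′)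
          (≈-trans (*ᴾ-comm p q′) (≈-trans (*ᴾ-congˡ q′ p≈p′) (*ᴾ-comm q′ p′)))
      ; *-assoc    = *ᴾ-assoc
      ; *-identity = comm∧idˡ⇒id *ᴾ-comm *ᴾ-identityˡ
      ; distrib    = comm∧distrʳ⇒distr +ᴾ-cong *ᴾ-comm *ᴾ-distribʳ-+ᴾ
      }
    ; *-comm = *ᴾ-comm
    }
  }
  where open Consequences polySetoid

module ℚ[x] where
  open CommutativeRing polyRing public
  open RingProperties ring public

-- Congruence modulo a polynomial

≈⇒mod : p ≈ q → p ≡ q [mod d ]
≈⇒mod p≈q = [] , p≈q

mod-sym : p ≡ q [mod d ] → q ≡ p [mod d ]
mod-sym {p} {q} {d} (c , p≈cd+q) = ℚ[x].- c , (begin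
  q                                        ≈⟨ ℚ[x].+-identityˡ q ⟨
  [] +ᴾ q                                  ≈⟨ ℚ[x].+-congʳ (ℚ[x].-‿inverseˡ (c *ᴾ d)) ⟨
  (ℚ[x].- (c *ᴾ d) +ᴾ c *ᴾ d) +ᴾ q         ≈⟨ ℚ[x].+-assoc (ℚ[x].- (c *ᴾ d)) (c *ᴾ d) q ⟩
  ℚ[x].- (c *ᴾ d) +ᴾ (c *ᴾ d +ᴾ q)         ≈⟨ ℚ[x].+-cong (ℚ[x].-‿distribˡ-* c d) (≈-sym p≈cd+q) ⟩
  (ℚ[x].- c) *ᴾ d +ᴾ p                     ∎)
  where open SetoidReasoning polySetoid

mod-trans : p ≡ q [mod d ] → q ≡ r [mod d ] → p ≡ r [mod d ]
mod-trans {p} {q} {d} {r} (c , p≈cd+q) (e , q≈ed+r) = c +ᴾ e , (begin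
  p                         ≈⟨ p≈cd+q ⟩
  c *ᴾ d +ᴾ q               ≈⟨ ℚ[x].+-congˡ q≈ed+r ⟩
  c *ᴾ d +ᴾ (e *ᴾ d +ᴾ r)   ≈⟨ ℚ[x].+-assoc (c *ᴾ d) (e *ᴾ d) r ⟨
  (c *ᴾ d +ᴾ e *ᴾ d) +ᴾ r   ≈⟨ ℚ[x].+-congʳ (ℚ[x].distribʳ d c e) ⟨
  (c +ᴾ e) *ᴾ d +ᴾ r        ∎)
  where open SetoidReasoning polySetoid

mod-*-congˡ : ∀ r → p ≡ q [mod d ] → r *ᴾ p ≡ r *ᴾ q [mod d ]
mod-*-congˡ {p} {q} {d} r (c , p≈cd+q) = r *ᴾ c , (begin
  r *ᴾ p                    ≈⟨ *ᴾ-congˡ r p≈cd+q ⟩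
  r *ᴾ (c *ᴾ d +ᴾ q)        ≈⟨ ℚ[x].distribˡ r (c *ᴾ d) q ⟩
  r *ᴾ (c *ᴾ d) +ᴾ r *ᴾ q   ≈⟨ ℚ[x].+-congʳ (ℚ[x].*-assoc r c d) ⟨
  (r *ᴾ c) *ᴾ d +ᴾ r *ᴾ q   ∎)
  where open SetoidReasoning polySetoid

mod-*-comm : ∀ p q → p *ᴾ q ≡ q *ᴾ p [mod d ]
mod-*-comm p q = ≈⇒mod (*ᴾ-comm p q)

mod-*-cong : p ≡ p′ [mod d ] → q ≡ q′ [mod d ] → p *ᴾ q ≡ p′ *ᴾ q′ [mod d ]
mod-*-cong {p} {p′} {d} {q} {q′} p≡p′ q≡q′ =
  mod-trans (mod-*-congˡ p q≡q′)
  (mod-trans (mod-*-comm p q′)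
  (mod-trans (mod-*-congˡ q′ p≡p′) (mod-*-comm q′ p′)))

-- The bundle makes setoid reasoning and the generic rearrangement lemmas for commutative semigroups
-- available for congruences.
modCommutativeMonoid : Poly → CommutativeMonoid 0ℓ 0ℓ
modCommutativeMonoid d = record
  { _≈_ = λ p q → p ≡ q [mod d ]
  ; _∙_ = _*ᴾ_
  ; ε   = 1ᴾ
  ; isCommutativeMonoid = record
    { isMonoid = record
      { isSemigroup = record
        { isMagma = record
          { isEquivalence = record
            { refl = ≈⇒mod ≈-refl ; sym = mod-sym ; trans = mod-trans }
          ; ∙-cong = mod-*-cong
          }
        ; assoc = λ p q r → ≈⇒mod (*ᴾ-assoc p q r)
        }
      ; identity = (λ p → ≈⇒mod (*ᴾ-identityˡ p)) , λ p → ≈⇒mod (ℚ[x].*-identityʳ p)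
      }
    ; comm = mod-*-comm
    }
  }

^ᴾ-distribˡ-+-* : ∀ p m n → p ^ᴾ (m ℕ.+ n) ≈ p ^ᴾ m *ᴾ p ^ᴾ n
^ᴾ-distribˡ-+-* p zero    n = ≈-sym (*ᴾ-identityˡ (p ^ᴾ n))
^ᴾ-distribˡ-+-* p (suc m) n = ≈-trans (*ᴾ-congˡ p (^ᴾ-distribˡ-+-* p m n))
  (≈-sym (*ᴾ-assoc p (p ^ᴾ m) (p ^ᴾ n)))

-- Uniqueness of the remainder modulo Ψₘ

-- `Ψ (suc n)` is monic of degree `n`, so a nonzero multiple has degree at least `n`. In the
-- induction on `c`, coefficient `i` of the tail's product, for `i ≥ n`, is coefficient `i + 1` of
-- the whole product, because Ψ contributes nothing there. The tail thus inherits the degree bound.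
Ψ-multiple-degree : ∀ n c → (Degree< n) (c *ᴾ Ψ (suc n)) → c *ᴾ Ψ (suc n) ≈ []
Ψ-multiple-degree n []      _   = ≈-refl
Ψ-multiple-degree n (a ∷ c) deg = begin
  a · Ψ (suc n) +ᴾ (0ℚ ∷ c *ᴾ Ψ (suc n)) ≈⟨ +ᴾ-congˡ {a · Ψ (suc n)} shifted≈[] ⟩
  a · Ψ (suc n) +ᴾ []                    ≈⟨ +ᴾ-identityʳ _ ⟩
  a · Ψ (suc n)                          ≡⟨ cong (_· Ψ (suc n)) a≡0 ⟩
  0ℚ · Ψ (suc n)                         ≈⟨ ·-zeroˡ (Ψ (suc n)) ⟩
  []                                     ∎
  where
  open SetoidReasoning polySetoid

  coeff-∷* : ∀ i → coeff ((a ∷ c) *ᴾ Ψ (suc n)) i ≡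
             a * coeff (Ψ (suc n)) i + coeff (0ℚ ∷ c *ᴾ Ψ (suc n)) i
  coeff-∷* i = trans (coeff-+ (a · Ψ (suc n)) (0ℚ ∷ c *ᴾ Ψ (suc n)) i)
    (cong (_+ coeff (0ℚ ∷ c *ᴾ Ψ (suc n)) i) (coeff-· a (Ψ (suc n)) i))

  c-deg : (Degree< n) (c *ᴾ Ψ (suc n))
  c-deg i n≤i = ≡.begin
    coeff (c *ᴾ Ψ (suc n)) i
      ≡.≡⟨ solve 2 (λ A C → C := A :* con 0ℚ :+ C) refl a (coeff (c *ᴾ Ψ (suc n)) i) ⟩
    a * 0ℚ + coeff (c *ᴾ Ψ (suc n)) i
      ≡.≡⟨ cong (λ u → a * u + coeff (c *ᴾ Ψ (suc n)) i) (Ψ-degree (suc n) (suc i) (s≤s n≤i)) ⟨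
    a * coeff (Ψ (suc n)) (suc i) + coeff (c *ᴾ Ψ (suc n)) i
      ≡.≡⟨ coeff-∷* (suc i) ⟨
    coeff ((a ∷ c) *ᴾ Ψ (suc n)) (suc i)
      ≡.≡⟨ deg (suc i) (ℕ.m≤n⇒m≤1+n n≤i) ⟩
    0ℚ ≡.∎
    where module ≡ = ≡-Reasoning

  shifted≈[] : 0ℚ ∷ c *ᴾ Ψ (suc n) ≈ []
  shifted≈[] = ≈-trans (∷-cong refl (Ψ-multiple-degree n c c-deg)) 0∷[]≈[]

  -- With the tail gone, coefficient `n` of the product is `a` times the leading coefficient 1 of Ψ.
  a≡0 : a ≡ 0ℚ
  a≡0 = ≡.begin
    a
      ≡.≡⟨ solve 1 (λ A → A := A :* con 1ℚ :+ con 0ℚ) refl a ⟩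
    a * 1ℚ + 0ℚ
      ≡.≡⟨ cong₂ (λ u t → a * u + t) (coeff-Ψ-last n) (coeff≡ shifted≈[] n) ⟨
    a * coeff (Ψ (suc n)) n + coeff (0ℚ ∷ c *ᴾ Ψ (suc n)) n
      ≡.≡⟨ coeff-∷* n ⟨
    coeff ((a ∷ c) *ᴾ Ψ (suc n)) n
      ≡.≡⟨ deg n ℕ.≤-refl ⟩
    0ℚ ≡.∎
    where module ≡ = ≡-Reasoning

-- The two degree bounds force the coefficients of `c *ᴾ Ψ (suc n)` to vanish from index `n` on, so
-- this multiple is zero.
reduced-unique : ∀ n → (Degree< n) p → (Degree< n) q → p ≡ q [mod Ψ (suc n) ] → p ≈ q
reduced-unique {p} {q} n p-deg q-deg (c , p≈cΨ+q) =
  ≈-trans p≈cΨ+q (+ᴾ-congʳ (Ψ-multiple-degree n c λ i n≤i → begin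
    coeff (c *ᴾ Ψ (suc n)) i
      ≡⟨ ℚ.+-identityʳ _ ⟨
    coeff (c *ᴾ Ψ (suc n)) i + 0ℚ
      ≡⟨ cong (coeff (c *ᴾ Ψ (suc n)) i +_) (q-deg i n≤i) ⟨
    coeff (c *ᴾ Ψ (suc n)) i + coeff q i
      ≡⟨ coeff-+ (c *ᴾ Ψ (suc n)) q i ⟨
    coeff (c *ᴾ Ψ (suc n) +ᴾ q) i
      ≡⟨ coeff≡ p≈cΨ+q i ⟨
    coeff p i
      ≡⟨ p-deg i n≤i ⟩
    0ℚ ∎))
  where open ≡-Reasoning

-- Integrality

IsInteger : ℚ → Set
IsInteger a = ∃ λ z → a ≡ fromℤ z

-- Addition in `ℚ` normalises its result, so the two sides are compared as unnormalised rationals,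
-- where the claim is an identity of integers.
fromℤ-homo-+ : ∀ y z → fromℤ y + fromℤ z ≡ fromℤ (y ℤ.+ z)
fromℤ-homo-+ y z = ℚ.toℚᵘ-injective (ℚᵘ.≃-trans (ℚ.toℚᵘ-homo-+ (fromℤ y) (fromℤ z))
  (ℚᵘ.*≡* (cong (ℤ._* ℤ.1ℤ) (cong₂ ℤ._+_ (ℤ.*-identityʳ y) (ℤ.*-identityʳ z)))))

fromℤ-homo-* : ∀ y z → fromℤ y * fromℤ z ≡ fromℤ (y ℤ.* z)
fromℤ-homo-* y z = ℚ.toℚᵘ-injective (ℚᵘ.≃-trans (ℚ.toℚᵘ-homo-* (fromℤ y) (fromℤ z))
  (ℚᵘ.*≡* refl))

+-integer : IsInteger a → IsInteger b → IsInteger (a + b)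
+-integer (y , refl) (z , refl) = y ℤ.+ z , fromℤ-homo-+ y z

*-integer : IsInteger a → IsInteger b → IsInteger (a * b)
*-integer (y , refl) (z , refl) = y ℤ.* z , fromℤ-homo-* y z

0-integer : IsInteger 0ℚ
0-integer = ℤ.0ℤ , refl

1-integer : IsInteger 1ℚ
1-integer = ℤ.1ℤ , refl

-1-integer : IsInteger (- 1ℚ)
-1-integer = ℤ.-1ℤ , refl

Integral : Poly → Set
Integral p = ∀ i → IsInteger (coeff p i)

[]-integral : Integral []
[]-integral _ = 0-integer

∷-integral : IsInteger a → Integral p → Integral (a ∷ p)
∷-integral a-int p-int zero    = a-int
∷-integral a-int p-int (suc i) = p-int i

≈-integral : p ≈ q → Integral p → Integral q
≈-integral p≈q p-int i = subst IsInteger (coeff≡ p≈q i) (p-int i)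

+ᴾ-integral : ∀ p q → Integral p → Integral q → Integral (p +ᴾ q)
+ᴾ-integral p q p-int q-int i =
  subst IsInteger (sym (coeff-+ p q i)) (+-integer (p-int i) (q-int i))

·-integral : ∀ p → IsInteger a → Integral p → Integral (a · p)
·-integral {a} p a-int p-int i =
  subst IsInteger (sym (coeff-· a p i)) (*-integer a-int (p-int i))

*ᴾ-integral : ∀ p q → Integral p → Integral q → Integral (p *ᴾ q)
*ᴾ-integral []      q p-int q-int = []-integral
*ᴾ-integral (a ∷ p) q p-int q-int = +ᴾ-integral (a · q) (0ℚ ∷ p *ᴾ q)
  (·-integral q (p-int 0) q-int)
  (∷-integral 0-integer (*ᴾ-integral p q (λ i → p-int (suc i)) q-int))

^ᴾ-integral : ∀ p n → Integral p → Integral (p ^ᴾ n)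
^ᴾ-integral p zero    p-int = ∷-integral 1-integer []-integral
^ᴾ-integral p (suc n) p-int = *ᴾ-integral p (p ^ᴾ n) p-int (^ᴾ-integral p n p-int)

Ψ-integral : ∀ m → Integral (Ψ m)
Ψ-integral zero    = []-integral
Ψ-integral (suc m) = ∷-integral 1-integer (Ψ-integral m)

1-x-integral : Integral 1-x
1-x-integral = ∷-integral 1-integer (∷-integral -1-integer []-integral)

-- The coefficients of `c` are recovered from the lowest upwards without division, as Ψ has constant
-- term 1: the head `a` is the constant term of the product, and subtracting `a · Ψ (suc n)` leaves
-- the shifted product of the tail, again integral.
Ψ-cofactor-integral : ∀ n c → Integral (c *ᴾ Ψ (suc n)) → Integral c
Ψ-cofactor-integral n []      _   = []-integral
Ψ-cofactor-integral n (a ∷ c) int =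
  ∷-integral a-int (Ψ-cofactor-integral n c λ i →
    subst IsInteger (drop-head i)
      (+-integer (int (suc i))
        (*-integer -1-integer (·-integral (Ψ (suc n)) a-int (Ψ-integral (suc n)) (suc i)))))
  where
  a-int : IsInteger a
  a-int = subst IsInteger (solve 1 (λ A → A :* con 1ℚ :+ con 0ℚ := A) refl a) (int 0)

  drop-head : ∀ i → coeff ((a ∷ c) *ᴾ Ψ (suc n)) (suc i) + - 1ℚ * coeff (a · Ψ (suc n)) (suc i)
                    ≡ coeff (c *ᴾ Ψ (suc n)) i
  drop-head i = trans
    (cong (_+ - 1ℚ * u) (coeff-+ (a · Ψ (suc n)) (0ℚ ∷ c *ᴾ Ψ (suc n)) (suc i)))
    (solve 2 (λ U T → (U :+ T) :+ con (- 1ℚ) :* U := T) refl u (coeff (c *ᴾ Ψ (suc n)) i))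
    where u = coeff (a · Ψ (suc n)) (suc i)

-- Evaluation at x = 1

eval₁ : Poly → ℚ
eval₁ []      = 0ℚ
eval₁ (a ∷ p) = a + eval₁ p

-- Equal polynomials may differ in trailing zeros. This covers the cases of `eval₁-cong` in which
-- one list ends first.
eval₁-zero : ∀ p → p ≈ [] → eval₁ p ≡ 0ℚ
eval₁-zero []      _    = refl
eval₁-zero (a ∷ p) p≈[] =
  cong₂ _+_ (coeff≡ p≈[] 0) (eval₁-zero p (mk≈ λ i → coeff≡ p≈[] (suc i)))

eval₁-cong : ∀ p q → p ≈ q → eval₁ p ≡ eval₁ q
eval₁-cong []      q       p≈q = sym (eval₁-zero q (≈-sym p≈q))
eval₁-cong (a ∷ p) []      p≈q = eval₁-zero (a ∷ p) p≈q
eval₁-cong (a ∷ p) (b ∷ q) p≈q =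
  cong₂ _+_ (coeff≡ p≈q 0) (eval₁-cong p q (mk≈ λ i → coeff≡ p≈q (suc i)))

eval₁-+ᴾ : ∀ p q → eval₁ (p +ᴾ q) ≡ eval₁ p + eval₁ q
eval₁-+ᴾ []      q       = sym (ℚ.+-identityˡ _)
eval₁-+ᴾ (a ∷ p) []      = sym (ℚ.+-identityʳ _)
eval₁-+ᴾ (a ∷ p) (b ∷ q) = trans (cong (a + b +_) (eval₁-+ᴾ p q))
  (solve 4 (λ A B P Q → (A :+ B) :+ (P :+ Q) := (A :+ P) :+ (B :+ Q)) refl
    a b (eval₁ p) (eval₁ q))

eval₁-· : ∀ c p → eval₁ (c · p) ≡ c * eval₁ p
eval₁-· c []      = sym (ℚ.*-zeroʳ c)
eval₁-· c (a ∷ p) = trans (cong (c * a +_) (eval₁-· c p)) (sym (ℚ.*-distribˡ-+ c a (eval₁ p)))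

eval₁-*ᴾ : ∀ p q → eval₁ (p *ᴾ q) ≡ eval₁ p * eval₁ q
eval₁-*ᴾ []      q = sym (ℚ.*-zeroˡ (eval₁ q))
eval₁-*ᴾ (a ∷ p) q = begin
  eval₁ (a · q +ᴾ (0ℚ ∷ p *ᴾ q))            ≡⟨ eval₁-+ᴾ (a · q) (0ℚ ∷ p *ᴾ q) ⟩
  eval₁ (a · q) + (0ℚ + eval₁ (p *ᴾ q))     ≡⟨ cong₂ (λ s t → s + (0ℚ + t)) (eval₁-· a q) (eval₁-*ᴾ p q) ⟩
  a * eval₁ q + (0ℚ + eval₁ p * eval₁ q)
    ≡⟨ solve 3 (λ A P Q → A :* Q :+ (con 0ℚ :+ P :* Q) := (A :+ P) :* Q) refl
         a (eval₁ p) (eval₁ q) ⟩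
  (a + eval₁ p) * eval₁ q                   ∎
  where open ≡-Reasoning

eval₁-Ψ : ∀ m → eval₁ (Ψ m) ≡ fromℤ (ℤ.+ m)
eval₁-Ψ zero    = refl
eval₁-Ψ (suc m) = trans (cong (1ℚ +_) (eval₁-Ψ m)) (fromℤ-homo-+ ℤ.1ℤ (ℤ.+ m))

eval₁-integer : ∀ p → Integral p → IsInteger (eval₁ p)
eval₁-integer []      p-int = 0-integer
eval₁-integer (a ∷ p) p-int = +-integer (p-int 0) (eval₁-integer p (λ i → p-int (suc i)))

-- A positive power has a factor 1 - x, whose value at 1 computes to `0ℚ`.
eval₁-1-x^suc : ∀ k → eval₁ (1-x ^ᴾ suc k) ≡ 0ℚ
eval₁-1-x^suc k = trans (eval₁-*ᴾ 1-x (1-x ^ᴾ k)) (ℚ.*-zeroˡ (eval₁ (1-x ^ᴾ k)))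

1-x-torsion-free : ∀ m .{{_ : NonTrivial m}} k → 1ᴾ ≡ 1-x ^ᴾ suc k [mod Ψ m ] → ⊥
1-x-torsion-free m@(suc (suc n)) k (c , 1≈cΨ+u) =
  -- Absolute values turn `z * m = 1` into an equation in ℕ, which forces `m = 1`.
  impossible (ℕ.m*n≡1⇒n≡1 ℤ.∣ z ∣ m (trans (sym (ℤ.abs-* z (ℤ.+ m))) (cong ℤ.∣_∣ zm≡1)))
  where
  open ≡-Reasoning

  u : Poly
  u = 1-x ^ᴾ suc k

  -- Isolating the multiple of Ψ puts a visibly integral polynomial on the other side, so `c` is
  -- integral.
  1-u≈cΨ : 1ᴾ +ᴾ - 1ℚ · u ≈ c *ᴾ Ψ m
  1-u≈cΨ = ≈-trans (+ᴾ-congʳ 1≈cΨ+u) (≈-trans (ℚ[x].+-assoc (c *ᴾ Ψ m) u (- 1ℚ · u))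
    (≈-trans (+ᴾ-congˡ (ℚ[x].-‿inverseʳ u)) (+ᴾ-identityʳ (c *ᴾ Ψ m))))

  c-integral : Integral c
  c-integral = Ψ-cofactor-integral (suc n) c (≈-integral 1-u≈cΨ
    (+ᴾ-integral 1ᴾ (- 1ℚ · u) (∷-integral 1-integer []-integral)
      (·-integral u -1-integer (^ᴾ-integral 1-x (suc k) 1-x-integral))))

  z : ℤ
  z = proj₁ (eval₁-integer c c-integral)

  -- Evaluation of `1 = c Ψ + u` at 1 kills `u`. Taking numerators brings the resulting equation
  -- from ℚ to ℤ.
  zm≡1 : z ℤ.* ℤ.+ m ≡ ℤ.1ℤ
  zm≡1 = cong ↥_ (begin
    fromℤ (z ℤ.* ℤ.+ m)       ≡⟨ fromℤ-homo-* z (ℤ.+ m) ⟨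
    fromℤ z * fromℤ (ℤ.+ m)   ≡⟨ cong₂ _*_ (proj₂ (eval₁-integer c c-integral)) (eval₁-Ψ m) ⟨
    eval₁ c * eval₁ (Ψ m)     ≡⟨ eval₁-*ᴾ c (Ψ m) ⟨
    eval₁ (c *ᴾ Ψ m)          ≡⟨ ℚ.+-identityʳ _ ⟨
    eval₁ (c *ᴾ Ψ m) + 0ℚ     ≡⟨ cong (eval₁ (c *ᴾ Ψ m) +_) (eval₁-1-x^suc k) ⟨
    eval₁ (c *ᴾ Ψ m) + eval₁ u ≡⟨ eval₁-+ᴾ (c *ᴾ Ψ m) u ⟨
    eval₁ (c *ᴾ Ψ m +ᴾ u)     ≡⟨ eval₁-cong 1ᴾ (c *ᴾ Ψ m +ᴾ u) 1≈cΨ+u ⟨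
    1ℚ                        ∎)

  impossible : m ≡ 1 → ⊥
  impossible ()

-- Remainders as canonical representatives of residue classes

module _ (m : ℕ) .{{m≥2 : NonTrivial m}} where

  private
    instance
      m≢0 : ℕ.NonZero m
      m≢0 = ℕ.nonTrivial⇒nonZero m

    u v : Poly
    u = 1-x
    v = proj₁ (1-x-invertible m)

  module Mod where
    open CommutativeMonoid (modCommutativeMonoid (Ψ m)) public
    open CommutativeSemigroupProperties commutativeSemigroup public

  module ModReasoning = SetoidReasoning Mod.setoid

  p≡rem[p] : ∀ p → p ≡ rem m p [mod Ψ m ]
  p≡rem[p] p = quotient (divΨ m p) , property (divΨ m p)

  rem-cong : p ≡ q [mod Ψ m ] → rem m p ≈ rem m q
  rem-cong {p} {q} p≡q = unique m (remainder-degree (divΨ m p)) (remainder-degree (divΨ m q))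
    (mod-trans (mod-sym (p≡rem[p] p)) (mod-trans p≡q (p≡rem[p] q)))
    where
    -- The module parameter cannot be split. A fresh `m` can, and in the form `suc n` its bound
    -- `m ∸ 1` reduces to the `n` of `reduced-unique`.
    unique : ∀ m .{{_ : ℕ.NonZero m}} → (Degree< (m ℕ.∸ 1)) p′ → (Degree< (m ℕ.∸ 1)) q′ →
             p′ ≡ q′ [mod Ψ m ] → p′ ≈ q′
    unique (suc n) = reduced-unique n

  rem-injective : ∀ p q → rem m p ≈ rem m q → p ≡ q [mod Ψ m ]
  rem-injective p q eq =
    mod-trans (p≡rem[p] p) (mod-trans (≈⇒mod eq) (mod-sym (p≡rem[p] q)))

  -- Law of exponents for powers of 1 - x modulo Ψₘ

  [1-x]^-⊖ : ∀ i j → u ^ᴾ i *ᴾ v ^ᴾ j ≡ [1-x]^ m (i ℤ.⊖ j) [mod Ψ m ]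
  [1-x]^-⊖ zero    zero    = Mod.identityˡ 1ᴾ
  [1-x]^-⊖ zero    (suc j) = Mod.identityˡ (v ^ᴾ suc j)
  [1-x]^-⊖ (suc i) zero    = Mod.identityʳ (u ^ᴾ suc i)
  [1-x]^-⊖ (suc i) (suc j) = begin
    (u *ᴾ u ^ᴾ i) *ᴾ (v *ᴾ v ^ᴾ j) ≈⟨ Mod.interchange u (u ^ᴾ i) v (v ^ᴾ j) ⟩
    -- One pair `u *ᴾ v`, congruent to 1, cancels, just as `⊖` drops a successor on each side.
    (u *ᴾ v) *ᴾ (u ^ᴾ i *ᴾ v ^ᴾ j) ≈⟨ Mod.∙-congʳ (proj₂ (1-x-invertible m)) ⟩
    1ᴾ *ᴾ (u ^ᴾ i *ᴾ v ^ᴾ j)       ≈⟨ Mod.identityˡ _ ⟩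
    u ^ᴾ i *ᴾ v ^ᴾ j               ≈⟨ [1-x]^-⊖ i j ⟩
    [1-x]^ m (i ℤ.⊖ j)             ≡⟨ cong ([1-x]^ m) (ℤ.[1+m]⊖[1+n]≡m⊖n i j) ⟨
    [1-x]^ m (suc i ℤ.⊖ suc j)     ∎
    where open ModReasoning

  -- For equal signs exponents add within one base, 1 - x or its inverse. For mixed signs the sum in
  -- ℤ reduces to a difference `⊖` of naturals, the case settled by `[1-x]^-⊖`.
  [1-x]^-homo : ∀ i j → [1-x]^ m i *ᴾ [1-x]^ m j ≡ [1-x]^ m (i ℤ.+ j) [mod Ψ m ]
  [1-x]^-homo (ℤ.+ i)  (ℤ.+ j)  = ≈⇒mod (≈-sym (^ᴾ-distribˡ-+-* u i j))
  [1-x]^-homo (ℤ.+ i)  -[1+ j ] = [1-x]^-⊖ i (suc j)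
  [1-x]^-homo -[1+ i ] (ℤ.+ j)  =
    mod-trans (mod-*-comm (v ^ᴾ suc i) (u ^ᴾ j)) ([1-x]^-⊖ j (suc i))
  [1-x]^-homo -[1+ i ] -[1+ j ] = begin
    v ^ᴾ suc i *ᴾ v ^ᴾ suc j    ≈⟨ ≈⇒mod (^ᴾ-distribˡ-+-* v (suc i) (suc j)) ⟨
    v ^ᴾ (suc i ℕ.+ suc j)      ≡⟨ cong (λ k → v ^ᴾ suc k) (ℕ.+-suc i j) ⟩
    v ^ᴾ suc (suc (i ℕ.+ j))    ∎
    where open ModReasoning

  -- Closure of G under multiplication

  mulMod-cong : p ≈ p′ → q ≈ q′ → mulMod m p q ≈ mulMod m p′ q′
  mulMod-cong p≈p′ q≈q′ = rem-cong (≈⇒mod (ℚ[x].*-cong p≈p′ q≈q′))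

  -- Each `f` is congruent to the power it was reduced from, so reducing before multiplying does not
  -- affect the final remainder.
  mulMod-f : ∀ j k → mulMod m (f m j) (f m k) ≈ f m (j ℤ.+ k)
  mulMod-f j k = rem-cong (begin
    f m j *ᴾ f m k                            ≈⟨ mod-*-cong (f-congruent m j) (f-congruent m k) ⟨
    [1-x]^ m (ℤ.- j) *ᴾ [1-x]^ m (ℤ.- k)      ≈⟨ [1-x]^-homo (ℤ.- j) (ℤ.- k) ⟩
    [1-x]^ m (ℤ.- j ℤ.+ ℤ.- k)                ≡⟨ cong ([1-x]^ m) (ℤ.neg-distrib-+ j k) ⟨
    [1-x]^ m (ℤ.- (j ℤ.+ k))                  ∎)
    where open ModReasoning

  -- The witness `j + k` makes the exponents recorded in members of G add definitionally under
  -- multiplication.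
  closed : Closed m
  closed (j , p≈fj) (k , q≈fk) = j ℤ.+ k , ≈-trans (mulMod-cong p≈fj q≈fk) (mulMod-f j k)

  -- The abelian group structure

  open Setoid (G-setoid m) using () renaming (_≈_ to _≈ᴳ_; isEquivalence to ≈ᴳ-isEquivalence)

  infixl 7 _∙_
  infix  8 _⁻¹

  _∙_ : ∃ (G m) → ∃ (G m) → ∃ (G m)
  _∙_ = mulG m closed

  exponent : ∃ (G m) → ℤ
  exponent (_ , k , _) = k

  pow : ℤ → ∃ (G m)
  pow k = f m k , k , ≈-refl

  ε : ∃ (G m)
  ε = pow ℤ.0ℤ

  _⁻¹ : ∃ (G m) → ∃ (G m)
  x ⁻¹ = pow (ℤ.- exponent x)

  -- Both polynomials equal the same `f m k`. Each group law thereby reduces to the law of (ℤ, +)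
  -- for the recorded exponents.
  exponent-injective : ∀ x y → exponent x ≡ exponent y → x ≈ᴳ y
  exponent-injective (_ , k , p≈fk) (_ , .k , q≈fk) refl = ≈-trans p≈fk (≈-sym q≈fk)

  ∙-cong : ∀ {x y z w} → x ≈ᴳ y → z ≈ᴳ w → x ∙ z ≈ᴳ y ∙ w
  ∙-cong = mulMod-cong

  ∙-assoc : ∀ x y z → (x ∙ y) ∙ z ≈ᴳ x ∙ (y ∙ z)
  ∙-assoc x y z = exponent-injective ((x ∙ y) ∙ z) (x ∙ (y ∙ z))
    (ℤ.+-assoc (exponent x) (exponent y) (exponent z))

  ∙-comm : ∀ x y → x ∙ y ≈ᴳ y ∙ x
  ∙-comm x y = exponent-injective (x ∙ y) (y ∙ x) (ℤ.+-comm (exponent x) (exponent y))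

  ∙-identity : (∀ x → ε ∙ x ≈ᴳ x) × (∀ x → x ∙ ε ≈ᴳ x)
  ∙-identity = (λ x → exponent-injective (ε ∙ x) x (ℤ.+-identityˡ (exponent x)))
             , (λ x → exponent-injective (x ∙ ε) x (ℤ.+-identityʳ (exponent x)))

  ∙-inverseˡ : ∀ x → x ⁻¹ ∙ x ≈ᴳ ε
  ∙-inverseˡ x = exponent-injective (x ⁻¹ ∙ x) ε (ℤ.+-inverseˡ (exponent x))

  ∙-inverseʳ : ∀ x → x ∙ x ⁻¹ ≈ᴳ ε
  ∙-inverseʳ x = exponent-injective (x ∙ x ⁻¹) ε (ℤ.+-inverseʳ (exponent x))

  -- Equal elements of G need not come with equal exponents, so this is not
  -- congruence of negation on ℤ but uniqueness of inverses.
  ⁻¹-cong : ∀ {x y} → x ≈ᴳ y → x ⁻¹ ≈ᴳ y ⁻¹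
  ⁻¹-cong {x} {y} x≈y =
    Consequences.assoc∧id∧invʳ⇒invˡ-unique (G-setoid m)
      {_∙_ = _∙_} {_⁻¹ = _⁻¹} {e = ε}
      (λ {x} {y} {z} {w} → ∙-cong {x} {y} {z} {w}) ∙-assoc ∙-identity ∙-inverseʳ (x ⁻¹) y
      x⁻¹∙y≈ε
    where
    x⁻¹∙y≈ε : x ⁻¹ ∙ y ≈ᴳ ε
    x⁻¹∙y≈ε = ≈-trans {proj₁ (x ⁻¹ ∙ y)} {proj₁ (x ⁻¹ ∙ x)} {proj₁ ε}
      (∙-cong {x ⁻¹} {x ⁻¹} {y} {x} ≈-refl (≈-sym x≈y)) (∙-inverseˡ x)

  G-isAbelianGroup : IsAbelianGroup _≈ᴳ_ _∙_ ε _⁻¹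
  G-isAbelianGroup = record
    { isGroup = record
      { isMonoid = record
        { isSemigroup = record
          { isMagma = record
            { isEquivalence = ≈ᴳ-isEquivalence
            ; ∙-cong = λ {x} {y} {z} {w} → ∙-cong {x} {y} {z} {w}
            }
          ; assoc = ∙-assoc
          }
        ; identity = ∙-identity
        }
      ; inverse = ∙-inverseˡ , ∙-inverseʳ
      ; ⁻¹-cong = λ {x} {y} → ⁻¹-cong {x} {y}
      }
    ; comm = ∙-comm
    }

  -- Infinitude of G

  1-x-cancel : u *ᴾ p ≡ u *ᴾ q [mod Ψ m ] → p ≡ q [mod Ψ m ]
  1-x-cancel {p} {q} up≡uq = begin
    p              ≈⟨ v*u* p ⟨
    v *ᴾ (u *ᴾ p)  ≈⟨ mod-*-congˡ v up≡uq ⟩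
    v *ᴾ (u *ᴾ q)  ≈⟨ v*u* q ⟩
    q              ∎
    where
    open ModReasoning

    -- Multiplication by the inverse `v` undoes multiplication by `u`.
    v*u* : ∀ r → v *ᴾ (u *ᴾ r) ≡ r [mod Ψ m ]
    v*u* r = begin
      v *ᴾ (u *ᴾ r)  ≈⟨ Mod.x∙yz≈yx∙z v u r ⟩
      (u *ᴾ v) *ᴾ r  ≈⟨ Mod.∙-congʳ (proj₂ (1-x-invertible m)) ⟩
      1ᴾ *ᴾ r        ≈⟨ Mod.identityˡ r ⟩
      r              ∎

  -- Common factors 1 - x are cancelled until one exponent is zero. If the other is still positive,
  -- some positive power of 1 - x would be congruent to 1, contradicting `1-x-torsion-free`.
  1-x^-injective : ∀ i j → u ^ᴾ i ≡ u ^ᴾ j [mod Ψ m ] → i ≡ j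
  1-x^-injective zero    zero    _  = refl
  1-x^-injective zero    (suc j) eq = ⊥-elim (1-x-torsion-free m j eq)
  1-x^-injective (suc i) zero    eq =
    ⊥-elim (1-x-torsion-free m i (mod-sym {u ^ᴾ suc i} {1ᴾ} eq))
  1-x^-injective (suc i) (suc j) eq =
    cong suc (1-x^-injective i j (1-x-cancel {u ^ᴾ i} {u ^ᴾ j} eq))

  f∘-‿injective : ∀ i j → f m (ℤ.- ℤ.+ i) ≈ f m (ℤ.- ℤ.+ j) → i ≡ j
  f∘-‿injective i j fi≈fj = 1-x^-injective i j (begin
    -- Since `f` at index k reduces the power with exponent -k, the index -i yields the natural
    -- power `u ^ᴾ i`.
    u ^ᴾ i                      ≡⟨ cong ([1-x]^ m) (ℤ.neg-involutive (ℤ.+ i)) ⟨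
    [1-x]^ m (ℤ.- (ℤ.- ℤ.+ i))  ≈⟨ rem-injective ([1-x]^ m (ℤ.- (ℤ.- ℤ.+ i)))
                                                 ([1-x]^ m (ℤ.- (ℤ.- ℤ.+ j))) fi≈fj ⟩
    [1-x]^ m (ℤ.- (ℤ.- ℤ.+ j))  ≡⟨ cong ([1-x]^ m) (ℤ.neg-involutive (ℤ.+ j)) ⟩
    u ^ᴾ j                      ∎)
    where open ModReasoning

  -- Infinitude is witnessed by the residues of the natural powers of 1 - x, which are pairwise
  -- distinct.
  ℕ↣G : Injection (setoid ℕ) (G-setoid m)
  ℕ↣G = record
    { to        = λ n → pow (ℤ.- ℤ.+ n)
    ; cong      = λ { refl → ≈-refl }
    ; injective = λ {i} {j} → f∘-‿injective i j
    }

mainTheorem5 : ∀ (m : ℕ) .{{_ : NonTrivial m}} →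
    (Σ[ closed ∈ Closed m ] ∃₂ λ ε _⁻¹ →
    IsAbelianGroup (Setoid._≈_ (G-setoid m)) (mulG m closed) ε _⁻¹)
    × Injection (setoid ℕ) (G-setoid m)
mainTheorem5 m = (closed m , ε m , _⁻¹ m , G-isAbelianGroup m) , ℕ↣G m
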